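{- Let $r$ be a positive integer and let $w$ be a finite word over $\{0,1\}$. If $\widetilde w$ is the word obtained by reversing the order of the bits of $w$, then $R_{0,0}(w,r)=R_{0,0}(\widetilde w,r)$ in $\mathbb{Z}[Y][[X]]$.
   Context: Given a finite word $w$ over $\{0,1\}$, extend it to a doubly infinite bit sequence $s:\mathbb{Z}\to\{0,1\}$ by adding infinitely many bits $0$ on its left and infinitely many bits $0$ on its right. A placement of $n$ $r$-ribbons (below the lattice path described by $s$: a unit step right for each bit $0$ and up for each bit $1$, read from left to right) is a sequence of positions $i_1<i_2<\cdots<i_n$ in $\mathbb{Z}$ such that one can successively, for $t=1,2,\dots,n$, perform the following change: the current bit sequence $s^{(t-1)}$ (with $s^{(0)}=s$) satisfies $s^{(t-1)}_{i_t-r}=1$ and $s^{(t-1)}_{i_t}=0$, and $s^{(t)}$ is obtained from it by setting the bit at $i_t-r$ to $0$ and the bit at $i_t$ to $1$. The height of the $t$-th ribbon is $\sum_{j=1}^{r-1}s^{(t-1)}_{i_t-j}$, and the total height of the placement is the sum of the heights of its $n$ ribbons. Then $$R_{0,0}(w,r)=\sum X^nY^{h},$$ the sum being over all placements of $r$-ribbons (all $n\ge0$, including the empty placement), where $n$ is the number of ribbons and $h$ the total height of the placement. (For each $n$ there are finitely many placements, so this is an element of $\mathbb{Z}[Y][[X]]$.) -}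

module Defs where

open import Data.Digit using (Bit; 0b; 1b)
import Data.Fin.Properties as Fin
open import Data.Fin.Base using (toℕ)
open import Data.Integer.Base as ℤ using (ℤ; +_; -[1+_])
import Data.Integer.Properties as ℤ
open import Data.List.Base
  using (List; []; _∷_; [_]; _++_; map; foldr; filter; upTo; replicate; length;
         cartesianProductWith)
open import Data.List.Membership.Propositional using (_∈_)
open import Data.List.Membership.Propositional.Properties
  using (∈-cartesianProductWith⁺; ∈-filter⁺; ∈-filter⁻; ∈-map⁺; ∈-upTo⁺)
open import Data.List.Relation.Unary.Any using (here)
open import Data.List.Relation.Unary.All using ([])
open import Data.List.Relation.Unary.AllPairs using ([]; _∷_)
open import Data.List.Relation.Unary.Unique.Propositional using (Unique)
import Data.List.Relation.Unary.Unique.Propositional.Properties as Unique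
open import Data.Nat.Base as ℕ using (ℕ; zero; suc; _∸_; s≤s; z≤n)
open import Data.Nat.ListAction using (sum)
import Data.Nat.Properties as ℕ
open import Data.Product.Base using (_×_; _,_; proj₁; proj₂; ∃-syntax; uncurry)
open import Data.Vec.Base using (Vec; []; _∷_)
open import Data.Vec.Properties using (∷-injective)
open import Data.Vec.Relation.Unary.All using (All; []; _∷_)
open import Data.Vec.Relation.Unary.Linked using (Linked; linked?)
open import Relation.Binary.PropositionalEquality
  using (_≡_; refl; sym; cong; subst; module ≡-Reasoning)
open import Relation.Nullary.Decidable using (Dec; yes; no; _×-dec_; map′)

------------------------------------------------------------------------
-- Bit sequences

BitSeq : Set
BitSeq = ℤ → Bit

-- The first letter of the word is put at position 0.  Another choice of
-- origin only translates the positions of ribbons.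

extend : List Bit → BitSeq
extend []      i          = 0b
extend (b ∷ w) (+ zero)   = b
extend (b ∷ w) (+ suc i)  = extend w (+ i)
extend (b ∷ w) (-[1+ i ]) = 0b

infixl 6 _[_]≔_

_[_]≔_ : BitSeq → ℤ → Bit → BitSeq
(s [ i ]≔ b) j with j ℤ.≟ i
... | yes _ = b
... | no  _ = s j

------------------------------------------------------------------------
-- Placements of r-ribbons

Addable : ℕ → BitSeq → ℤ → Set
Addable r s i = s (i ℤ.- + r) ≡ 1b × s i ≡ 0b

addRibbon : ℕ → BitSeq → ℤ → BitSeq
addRibbon r s i = s [ i ℤ.- + r ]≔ 0b [ i ]≔ 1b

ribbonHeight : ℕ → BitSeq → ℤ → ℕ
ribbonHeight r s i = sum (map (λ j → toℕ (s (i ℤ.- + suc j))) (upTo (r ∸ 1)))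

data Performable (r : ℕ) : ∀ {n} → BitSeq → Vec ℤ n → Set where
  []  : ∀ {s} → Performable r s []
  _∷_ : ∀ {s n i} {is : Vec ℤ n} →
        Addable r s i → Performable r (addRibbon r s i) is →
        Performable r s (i ∷ is)

IsPlacement : ℕ → BitSeq → ∀ {n} → Vec ℤ n → Set
IsPlacement r s is = Linked ℤ._<_ is × Performable r s is

totalHeight : ℕ → BitSeq → ∀ {n} → Vec ℤ n → ℕ
totalHeight r s []       = 0
totalHeight r s (i ∷ is) =
  ribbonHeight r s i ℕ.+ totalHeight r (addRibbon r s i) is

addable? : ∀ r s i → Dec (Addable r s i)
addable? r s i = (s (i ℤ.- + r) Fin.≟ 1b) ×-dec (s i Fin.≟ 0b)

performable? : ∀ r s {n} (is : Vec ℤ n) → Dec (Performable r s is)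
performable? r s []       = yes []
performable? r s (i ∷ is) =
  map′ (uncurry _∷_) (λ { (a ∷ p) → a , p })
       (addable? r s i ×-dec performable? r (addRibbon r s i) is)

isPlacement? : ∀ r s {n} (is : Vec ℤ n) → Dec (IsPlacement r s is)
isPlacement? r s is = linked? ℤ._<?_ is ×-dec performable? r s is

------------------------------------------------------------------------
-- The finite list of all placements of n ribbons

vectors : ∀ {A : Set} → List A → ∀ n → List (Vec A n)
vectors xs zero    = [ [] ]
vectors xs (suc n) = cartesianProductWith _∷_ xs (vectors xs n)

-- Each ribbon extends the range of the bits 1 by at most r to the right, so
-- all positions lie in the interval [0, length w + n r); see
-- ∈-placements⁺, ∈-placements⁻ and placements-unique.

placements : List Bit → ℕ → ∀ n → List (Vec ℤ n)
placements w r n =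
  filter (isPlacement? r (extend w))
         (vectors (map +_ (upTo (length w ℕ.+ n ℕ.* r))) n)

Supported : ℕ → BitSeq → Set
Supported m s = ∀ i → s i ≡ 1b → ∃[ k ] i ≡ + k × k ℕ.< m

extend-supported : ∀ w → Supported (length w) (extend w)
extend-supported (b ∷ w) (+ zero)  eq = 0 , refl , s≤s z≤n
extend-supported (b ∷ w) (+ suc i) eq with extend-supported w (+ i) eq
... | k , refl , k<m = suc k , refl , s≤s k<m

addable-bound : ∀ {m r s i} → Supported m s → Addable r s i →
                ∃[ k ] i ≡ + k × k ℕ.< m ℕ.+ r
addable-bound {m} {r} {s} {i} sup (eq , _) with sup _ eq
... | k , i-r≡k , k<m = k ℕ.+ r , i≡k+r , ℕ.+-monoˡ-< r k<m
  where
  open ≡-Reasoning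
  i≡k+r : i ≡ + (k ℕ.+ r)
  i≡k+r = begin
    i                            ≡⟨ ℤ.+-identityʳ i ⟨
    i ℤ.+ ℤ.0ℤ                   ≡⟨ cong (λ z → i ℤ.+ z) (ℤ.+-inverseˡ (+ r)) ⟨
    i ℤ.+ (ℤ.- + r ℤ.+ + r)      ≡⟨ ℤ.+-assoc i (ℤ.- + r) (+ r) ⟨
    i ℤ.- + r ℤ.+ + r            ≡⟨ cong (λ z → z ℤ.+ + r) i-r≡k ⟩
    + (k ℕ.+ r)                  ∎

addRibbon-supported : ∀ {m r s i} → Supported m s → Addable r s i →
                      Supported (m ℕ.+ r) (addRibbon r s i)
addRibbon-supported {m} {r} {s} {i} sup a j eq with j ℤ.≟ i
... | yes refl = addable-bound {s = s} sup a
... | no  _ with j ℤ.≟ i ℤ.- + r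
...   | no _ with sup j eq
...     | k , j≡k , k<m = k , j≡k , ℕ.<-≤-trans k<m (ℕ.m≤m+n m r)

private
  InRange : ℕ → ℤ → Set
  InRange m i = i ∈ map +_ (upTo m)

  inRange : ∀ {m m′ i} → m ℕ.≤ m′ → (∃[ k ] i ≡ + k × k ℕ.< m) → InRange m′ i
  inRange m≤m′ (k , refl , k<m) = ∈-map⁺ +_ (∈-upTo⁺ (ℕ.<-≤-trans k<m m≤m′))

  performable-bound : ∀ {m M r s n} {is : Vec ℤ n} → Supported m s →
                      m ℕ.+ n ℕ.* r ℕ.≤ M → Performable r s is →
                      All (InRange M) is
  performable-bound sup le [] = []
  performable-bound {m} {M} {r} {s} {suc n} sup le (a ∷ p) =
    inRange (ℕ.m+n≤o⇒m≤o (m ℕ.+ r) le′) (addable-bound {s = s} sup a) ∷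
    performable-bound (addRibbon-supported {s = s} sup a) le′ p
    where
    le′ : (m ℕ.+ r) ℕ.+ n ℕ.* r ℕ.≤ M
    le′ = subst (ℕ._≤ M) (sym (ℕ.+-assoc m r (n ℕ.* r))) le

  ∈-vectors⁺ : ∀ {A : Set} {xs : List A} {n} {v : Vec A n} →
               All (_∈ xs) v → v ∈ vectors xs n
  ∈-vectors⁺ []       = here refl
  ∈-vectors⁺ (p ∷ ps) = ∈-cartesianProductWith⁺ _∷_ p (∈-vectors⁺ ps)

  vectors-unique : ∀ {A : Set} {xs : List A} → Unique xs →
                   ∀ n → Unique (vectors xs n)
  vectors-unique xs! zero    = [] ∷ []
  vectors-unique xs! (suc n) =
    Unique.cartesianProductWith⁺ _∷_ ∷-injective xs! (vectors-unique xs! n)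

∈-placements⁺ : ∀ w r {n} {is : Vec ℤ n} →
                IsPlacement r (extend w) is → is ∈ placements w r n
∈-placements⁺ w r p =
  ∈-filter⁺ (isPlacement? r (extend w))
    (∈-vectors⁺ (performable-bound (extend-supported w) ℕ.≤-refl (proj₂ p))) p

∈-placements⁻ : ∀ w r {n} {is : Vec ℤ n} →
                is ∈ placements w r n → IsPlacement r (extend w) is
∈-placements⁻ w r {n} is∈ =
  proj₂ (∈-filter⁻ (isPlacement? r (extend w))
    {xs = vectors (map +_ (upTo (length w ℕ.+ n ℕ.* r))) n} is∈)

placements-unique : ∀ w r n → Unique (placements w r n)
placements-unique w r n =
  Unique.filter⁺ (isPlacement? r (extend w))
    (vectors-unique (Unique.map⁺ ℤ.+-injective (Unique.upTo⁺ _)) n)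

------------------------------------------------------------------------
-- ℤ[Y] and ℤ[Y][[X]]

-- Coefficient lists, lowest degree first; trailing zeros are allowed, and
-- polynomials are compared by _≈ₚ_.

ℤ[Y] : Set
ℤ[Y] = List ℤ

coeff : ℤ[Y] → ℕ → ℤ
coeff []      k       = ℤ.0ℤ
coeff (a ∷ p) zero    = a
coeff (a ∷ p) (suc k) = coeff p k

infix 4 _≈ₚ_ _≈_

_≈ₚ_ : ℤ[Y] → ℤ[Y] → Set
p ≈ₚ q = ∀ k → coeff p k ≡ coeff q k

0ₚ : ℤ[Y]
0ₚ = []

infixl 6 _+ₚ_

_+ₚ_ : ℤ[Y] → ℤ[Y] → ℤ[Y]
[]      +ₚ q       = q
(a ∷ p) +ₚ []      = a ∷ p
(a ∷ p) +ₚ (b ∷ q) = (a ℤ.+ b) ∷ (p +ₚ q)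

Y^_ : ℕ → ℤ[Y]
Y^ h = replicate h ℤ.0ℤ ++ [ ℤ.1ℤ ]

sumₚ : List ℤ[Y] → ℤ[Y]
sumₚ = foldr _+ₚ_ 0ₚ

-- A power series in X is the sequence of its coefficients.

ℤ[Y]⟦X⟧ : Set
ℤ[Y]⟦X⟧ = ℕ → ℤ[Y]

_≈_ : ℤ[Y]⟦X⟧ → ℤ[Y]⟦X⟧ → Set
f ≈ g = ∀ n → f n ≈ₚ g n

------------------------------------------------------------------------

R₀₀ : List Bit → ℕ → ℤ[Y]⟦X⟧
R₀₀ w r n = sumₚ (map (λ is → Y^ totalHeight r (extend w) is) (placements w r n))

{-# OPTIONS --safe #-}

-- Read the bits from left to right, keeping a window of the last r current bits.
-- A ribbon at the next position exchanges its bit 0 with the oldest bit 1 of the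
-- window, at the cost X Y^(other ones of the window); each letter thus acts by a
-- linear operator on series-valued functions of windows.  Once only zeros
-- remain, a window with c ones contributes φ c = ∏_{j<c} 1 / (1 - X Yʲ).
--
-- For windows a, b of length r let ⟨a, b⟩ be the series of the word a followed
-- by the reversal of b.  It has a recursion over the r pairs of bits at distance
-- r, and the effect of adjoining a pair at the left end mirrors that at the right
-- end.  Hence every letter acts on a as it acts on b: the operators are
-- self-adjoint for ⟨_,_⟩, and moving them across reverses the word.

module Submission where

open import Algebra.Bundles using (CommutativeMonoid)
open import Algebra.Properties.CommutativeSemigroup using (interchange)
open import Data.Digit using (Bit; 0b; 1b)
open import Data.Empty using (⊥)
open import Data.Fin.Base using (zero; suc; toℕ)
open import Data.Integer.Base as ℤ using (ℤ; +_; 0ℤ)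
import Data.Integer.Properties as ℤ
open import Algebra.Properties.AbelianGroup ℤ.+-0-abelianGroup
  using () renaming (∙-cancelˡ to +-cancelˡ)
open import Data.Integer.Tactic.RingSolver using (solve-∀)
open import Data.List.Base as List
  using (List; []; _∷_; _++_; map; foldr; length; reverse; replicate; upTo)
open import Data.List.Membership.Propositional using (_∈_)
open import Data.List.Membership.Propositional.Properties
  using (∈-++⁺ˡ; ∈-++⁺ʳ; ∈-++⁻; ∈-cartesianProductWith⁻; ∈-filter⁻; ∈-map⁺; ∈-map⁻; ∈-upTo⁻)
open import Data.List.Membership.Propositional.Properties.WithK using (unique∧set⇒bag)
open import Data.List.Properties
  using (foldr-++; foldr-∷ʳ; map-++; map-∘; map-cong; length-++; length-replicate;
         unfold-reverse; upTo-∷ʳ; ∷ʳ-++)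
open import Data.List.Relation.Binary.BagAndSetEquality using (∼bag⇒↭)
open import Data.List.Relation.Binary.Permutation.Propositional using (_↭_; ↭⇒↭ₛ)
import Data.List.Relation.Binary.Permutation.Propositional.Properties as ↭
open import Data.List.Relation.Binary.Permutation.Setoid.Properties using (foldr-commMonoid)
open import Data.List.Relation.Unary.All using ([])
open import Data.List.Relation.Unary.AllPairs using ([]; _∷_)
open import Data.List.Relation.Unary.Any using (here)
open import Data.List.Relation.Unary.Unique.Propositional using (Unique)
import Data.List.Relation.Unary.Unique.Propositional.Properties as Unique
open import Data.Nat.Base
  using (ℕ; zero; suc; _+_; _*_; _≤_; _<_; z≤n; s≤s; s≤s⁻¹; NonZero; ≢-nonZero⁻¹)
open import Data.Nat.ListAction using (sum)
open import Data.Nat.ListAction.Properties using (sum-++)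
import Data.Nat.Properties as ℕ
open import Data.Product.Base using (_×_; _,_; proj₁; ∃-syntax)
open import Data.Sum.Base using (inj₁; inj₂)
open import Data.Vec.Base as Vec using (Vec; []; _∷_; _∷ʳ_; toList)
open import Data.Vec.Properties using (∷-injectiveʳ; reverse-∷; toList-∷ʳ)
open import Data.Vec.Relation.Unary.All as All using (All; []; _∷_)
open import Data.Vec.Relation.Unary.Linked as Linked using (Linked; []; [-]; _∷_)
open import Data.Vec.Relation.Unary.Linked.Properties using (Linked⇒All)
open import Function.Base using (_∘_)
open import Function.Bundles using (mk⇔)
open import Relation.Binary.PropositionalEquality
  using (_≡_; _≢_; refl; sym; trans; cong; cong₂; subst; module ≡-Reasoning)
open import Relation.Nullary.Decidable using (Dec; yes; no)
open import Relation.Nullary.Negation using (¬_; contradiction)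

open import Defs

private
  variable
    k l m n r t : ℕ

-- Series in X and Y

-- A series Σ f_{n,j} Xⁿ Yʲ is represented by (n, h) ↦ Σ_j f_{n,j} ω (h + j)
-- for an arbitrary fixed ω : ℕ → ℤ, so that multiplication by Yᵐ shifts h.

Series : Set
Series = ℕ → ℕ → ℤ

private
  variable
    f g f′ g′ e : Series

infix  4 _≐_
infixl 6 _⊕_

_≐_ : Series → Series → Set
f ≐ g = ∀ n h → f n h ≡ g n h

_⊕_ : Series → Series → Series
(f ⊕ g) n h = f n h ℤ.+ g n h

-- Multiplication by x X Yᵐ; the factor x ∈ {0, 1} switches the term off.

move : Bit → ℕ → Series → Series
move zero       m f n       h = 0ℤ
move (suc zero) m f zero    h = 0ℤ
move (suc zero) m f (suc n) h = f n (h + m)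

≐-sym : f ≐ g → g ≐ f
≐-sym p n h = sym (p n h)

≐-trans : f ≐ g → g ≐ e → f ≐ e
≐-trans p q n h = trans (p n h) (q n h)

⊕-cong : f ≐ f′ → g ≐ g′ → f ⊕ g ≐ f′ ⊕ g′
⊕-cong p q n h = cong₂ ℤ._+_ (p n h) (q n h)

⊕-identityʳ : ∀ m f g → f ⊕ move 0b m g ≐ f
⊕-identityʳ m f g n h = ℤ.+-identityʳ (f n h)

-- Multiplication by `X` never lowers the order, so agreement up to order `n` is enough. This
-- truncated form is needed because finitely many padding zeros reproduce `φ` only up to a given
-- order.
move-cong-≤ : ∀ x m n → (∀ i → i ≤ n → ∀ h → f i h ≡ g i h) →
              ∀ h → move x m f n h ≡ move x m g n h
move-cong-≤ zero       m n       p h = refl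
move-cong-≤ (suc zero) m zero    p h = refl
move-cong-≤ (suc zero) m (suc n) p h = p n (ℕ.n≤1+n n) (h + m)

move-cong : ∀ x → l ≡ m → f ≐ g → move x l f ≐ move x m g
move-cong {m = m} x refl p n = move-cong-≤ x m n (λ i _ → p i)

move-⊕ : ∀ x m f g → move x m (f ⊕ g) ≐ move x m f ⊕ move x m g
move-⊕ zero       m f g n       h = refl
move-⊕ (suc zero) m f g zero    h = refl
move-⊕ (suc zero) m f g (suc n) h = refl

move-comm : ∀ x y → k + l ≡ m + n → move x k (move y l f) ≐ move y m (move x n f)
move-comm zero       zero       eq i             h = refl
move-comm zero       (suc zero) eq zero          h = refl
move-comm zero       (suc zero) eq (suc i)       h = refl
move-comm (suc zero) zero       eq zero          h = refl
move-comm (suc zero) zero       eq (suc i)       h = refl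
move-comm (suc zero) (suc zero) eq zero          h = refl
move-comm (suc zero) (suc zero) eq (suc zero)    h = refl
move-comm {k} {l} {m} {n} {f} (suc zero) (suc zero) eq (suc (suc i)) h = cong (f i) (begin
  h + k + l    ≡⟨ ℕ.+-assoc h k l ⟩
  h + (k + l)  ≡⟨ cong (_+_ h) eq ⟩
  h + (m + n)  ≡⟨ ℕ.+-assoc h m n ⟨
  h + m + n    ∎)
  where open ≡-Reasoning

⊕-interchange : ∀ f g f′ g′ → (f ⊕ g) ⊕ (f′ ⊕ g′) ≐ (f ⊕ f′) ⊕ (g ⊕ g′)
⊕-interchange f g f′ g′ n h =
  interchange ℤ.+-commutativeSemigroup (f n h) (g n h) (f′ n h) (g′ n h)

-- Expanded, both sides consist of four terms: the two single moves trade places, and the double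
-- moves agree because their total exponents of Y do.
move-exchange : ∀ x y → k + l ≡ m + n →
  (f ⊕ move y m g) ⊕ move x k (f′ ⊕ move y l e) ≐
  (f ⊕ move x k f′) ⊕ move y m (g ⊕ move x n e)
move-exchange {k} {l} {m} {n} {f} {g} {f′} {e} x y eq =
  ≐-trans (⊕-cong {f = f ⊕ move y m g} (λ _ _ → refl) (move-⊕ x k f′ (move y l e)))
  (≐-trans (⊕-interchange f (move y m g) (move x k f′) (move x k (move y l e)))
  (⊕-cong {f = f ⊕ move x k f′} (λ _ _ → refl)
    (≐-trans (⊕-cong {f = move y m g} (λ _ _ → refl) (move-comm x y eq))
             (≐-sym (move-⊕ y m g (move x n e))))))

-- Windows

ones : Vec Bit t → ℕ
ones a = Vec.sum (Vec.map toℕ a)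

ones-∷ʳ : ∀ (a : Vec Bit t) x → ones (a ∷ʳ x) ≡ toℕ x + ones a
ones-∷ʳ []               x = refl
ones-∷ʳ (zero ∷ a)       x = ones-∷ʳ a x
ones-∷ʳ (suc zero ∷ a)   x = trans (cong suc (ones-∷ʳ a x)) (sym (ℕ.+-suc (toℕ x) (ones a)))

ones-reverse : ∀ (a : Vec Bit t) → ones (Vec.reverse a) ≡ ones a
ones-reverse []      = refl
ones-reverse (x ∷ a) = begin
  ones (Vec.reverse (x ∷ a))        ≡⟨ cong ones (reverse-∷ x a) ⟩
  ones (Vec.reverse a ∷ʳ x)         ≡⟨ ones-∷ʳ (Vec.reverse a) x ⟩
  toℕ x + ones (Vec.reverse a)      ≡⟨ cong (_+_ (toℕ x)) (ones-reverse a) ⟩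
  toℕ x + ones a                    ∎
  where open ≡-Reasoning

reverse-∷ʳ : ∀ {A : Set} (xs : Vec A t) x → Vec.reverse (xs ∷ʳ x) ≡ x ∷ Vec.reverse xs
reverse-∷ʳ []       x = refl
reverse-∷ʳ (y ∷ xs) x = begin
  Vec.reverse (y ∷ (xs ∷ʳ x))     ≡⟨ reverse-∷ y (xs ∷ʳ x) ⟩
  Vec.reverse (xs ∷ʳ x) ∷ʳ y      ≡⟨ cong (_∷ʳ y) (reverse-∷ʳ xs x) ⟩
  x ∷ (Vec.reverse xs ∷ʳ y)       ≡⟨ cong (x ∷_) (reverse-∷ y xs) ⟨
  x ∷ Vec.reverse (y ∷ xs)        ∎
  where open ≡-Reasoning

zeros : ∀ t → Vec Bit t
zeros t = Vec.replicate t 0b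

ones-zeros : ∀ t → ones (zeros t) ≡ 0
ones-zeros zero    = refl
ones-zeros (suc t) = ones-zeros t

zeros-∷ʳ : ∀ t → zeros t ∷ʳ 0b ≡ 0b ∷ zeros t
zeros-∷ʳ zero    = refl
zeros-∷ʳ (suc t) = cong (0b ∷_) (zeros-∷ʳ t)

reverse-zeros : ∀ t → Vec.reverse (zeros t) ≡ zeros t
reverse-zeros zero    = refl
reverse-zeros (suc t) = begin
  Vec.reverse (0b ∷ zeros t)      ≡⟨ reverse-∷ 0b (zeros t) ⟩
  Vec.reverse (zeros t) ∷ʳ 0b     ≡⟨ cong (_∷ʳ 0b) (reverse-zeros t) ⟩
  zeros t ∷ʳ 0b                   ≡⟨ zeros-∷ʳ t ⟩
  0b ∷ zeros t                    ∎
  where open ≡-Reasoning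

-- Transfer operators on functions of windows

-- The window (x ∷ a) holds the current bits at i - r, …, i - 1, and c is the
-- bit at i.  A ribbon at i is possible if x = 1 and c = 0; its height is ones a.

step : Bit → (Vec Bit (suc r) → Series) → Vec Bit (suc r) → Series
step zero       F (x ∷ a) = F (a ∷ʳ 0b) ⊕ move x (ones a) (F (a ∷ʳ 1b))
step (suc zero) F (x ∷ a) = F (a ∷ʳ 1b)

transfer : (Vec Bit (suc r) → Series) → List Bit → Vec Bit (suc r) → Series
transfer = foldr step

step-cong-≤ : ∀ c {F G : Vec Bit (suc r) → Series} n →
              (∀ a i → i ≤ n → ∀ h → F a i h ≡ G a i h) →
              ∀ a h → step c F a n h ≡ step c G a n h
step-cong-≤ zero       n p (x ∷ a) h =
  cong₂ ℤ._+_ (p _ n ℕ.≤-refl h) (move-cong-≤ x (ones a) n (p _) h)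
step-cong-≤ (suc zero) n p (x ∷ a) h = p _ n ℕ.≤-refl h

transfer-cong-≤ : ∀ v {F G : Vec Bit (suc r) → Series} n →
                  (∀ a i → i ≤ n → ∀ h → F a i h ≡ G a i h) →
                  ∀ a h → transfer F v a n h ≡ transfer G v a n h
transfer-cong-≤ []      n p a h = p a n ℕ.≤-refl h
transfer-cong-≤ (c ∷ v) n p =
  step-cong-≤ c n (λ a i i≤n →
    transfer-cong-≤ v i (λ b j j≤i → p b j (ℕ.≤-trans j≤i i≤n)) a)

step-cong : ∀ c {F G : Vec Bit (suc r) → Series} →
            (∀ a → F a ≐ G a) → ∀ a → step c F a ≐ step c G a
step-cong c p a n = step-cong-≤ c n (λ b i _ → p b i) a

transfer-cong : ∀ v {F G : Vec Bit (suc r) → Series} →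
                (∀ a → F a ≐ G a) → ∀ a → transfer F v a ≐ transfer G v a
transfer-cong v p a n = transfer-cong-≤ v n (λ b i _ → p b i) a

-- The two operators act on different arguments of `K`. If both letters are 0, the exponent of each
-- move depends on its own window alone, so `move-exchange` applies.
step-step-comm : ∀ c d (K : Vec Bit (suc r) → Vec Bit (suc r) → Series) a b →
  step c (λ a → step d (K a) b) a ≐ step d (λ b → step c (λ a → K a b) a) b
step-step-comm zero zero K (x ∷ a) (y ∷ b) =
  move-exchange {f = K (a ∷ʳ 0b) (b ∷ʳ 0b)} x y (ℕ.+-comm (ones a) (ones b))
step-step-comm zero       (suc zero) K (x ∷ a) (y ∷ b) n h = refl
step-step-comm (suc zero) zero       K (x ∷ a) (y ∷ b) n h = refl
step-step-comm (suc zero) (suc zero) K (x ∷ a) (y ∷ b) n h = refl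

step-transfer-comm : ∀ c v (K : Vec Bit (suc r) → Vec Bit (suc r) → Series) a b →
  step c (λ a → transfer (K a) v b) a ≐ transfer (λ b → step c (λ a → K a b) a) v b
step-transfer-comm c []      K a b n h = refl
step-transfer-comm c (d ∷ v) K a b =
  ≐-trans (step-step-comm c d (λ a → transfer (K a) v) a b)
          (step-cong d (step-transfer-comm c v K a) b)

-- Letters cross from `a` to `b` one at a time. The first letter acts outermost on `a`; commuted
-- past the operators already on the side of `b`, it acts innermost there and so becomes the last
-- letter.
transfer-adjoint : ∀ (K : Vec Bit (suc r) → Vec Bit (suc r) → Series) →
  (∀ c a b → step c (λ a → K a b) a ≐ step c (K a) b) →
  ∀ v a b → transfer (λ a → K a b) v a ≐ transfer (K a) (reverse v) b
transfer-adjoint K adj []      a b n h = refl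
transfer-adjoint K adj (c ∷ v) a b n h = begin
  step c (transfer (λ a → K a b) v) a n h
    ≡⟨ step-cong c (λ a → transfer-adjoint K adj v a b) a n h ⟩
  step c (λ a → transfer (K a) (reverse v) b) a n h
    ≡⟨ step-transfer-comm c (reverse v) K a b n h ⟩
  transfer (λ b → step c (λ a → K a b) a) (reverse v) b n h
    ≡⟨ transfer-cong (reverse v) (adj c a) b n h ⟩
  transfer (step c (K a)) (reverse v) b n h
    ≡⟨ cong (λ F → F b n h) (foldr-∷ʳ step (K a) c (reverse v)) ⟨
  transfer (K a) (reverse v List.∷ʳ c) b n h
    ≡⟨ cong (λ u → transfer (K a) u b n h) (unfold-reverse c v) ⟨
  transfer (K a) (reverse (c ∷ v)) b n h
    ∎
  where open ≡-Reasoning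

-- The pairing of two windows

module _ (ω : ℕ → ℤ) where

  -- φ c = ∏_{j < c} 1 / (1 - X Yʲ)

  φ : ℕ → Series
  φ c       zero    h = ω h
  φ zero    (suc n) h = 0ℤ
  φ (suc c) (suc n) h = φ c (suc n) h ℤ.+ φ (suc c) n (h + c)

  -- This is (1 - X Yᶜ) `φ (suc c)` = `φ c`, the only fact about `φ` on which the pairing relies.
  φ-suc : ∀ c → φ (suc c) ≐ φ c ⊕ move 1b c (φ (suc c))
  φ-suc c zero    h = sym (ℤ.+-identityʳ (ω h))
  φ-suc c (suc n) h = refl

  -- pairing 0 a b is the series of the word a ++ b.  The recursion treats the
  -- pairs of bits at distance r from left to right, with c ones in the pairs
  -- before: in a pair (x , 1) the result is 1, in a pair (x , 0) a ribbon may
  -- move x past the later ones of a and the c earlier ones.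

  pairing : ℕ → Vec Bit t → Vec Bit t → Series
  pairing c []      []             = φ c
  pairing c (x ∷ a) (zero ∷ b)     = pairing c a b ⊕ move x (ones a + c) (pairing (suc c) a b)
  pairing c (x ∷ a) (suc zero ∷ b) = pairing (suc c) a b

  -- Mirrors the defining clause for a first pair (x , 1). In the base case with `y` = 0, the
  -- optional ribbon completes `φ c` to `φ (suc c)`. In the induction the extra 1 counts in `ones`
  -- on one side and in the counter on the other.
  pairing-∷ʳ-1b : ∀ c (a b : Vec Bit t) y →
                  pairing c (a ∷ʳ 1b) (b ∷ʳ y) ≐ pairing (suc c) a b
  pairing-∷ʳ-1b c []      []             zero       = ≐-sym (φ-suc c)
  pairing-∷ʳ-1b c []      []             (suc zero) n h = refl
  pairing-∷ʳ-1b c (x ∷ a) (zero ∷ b)     y          =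
    ⊕-cong (pairing-∷ʳ-1b c a b y)
           (move-cong x (trans (cong (_+ c) (ones-∷ʳ a 1b)) (sym (ℕ.+-suc (ones a) c)))
                      (pairing-∷ʳ-1b (suc c) a b y))
  pairing-∷ʳ-1b c (x ∷ a) (suc zero ∷ b) y          = pairing-∷ʳ-1b (suc c) a b y

  -- Mirrors the defining clause for a first pair (x , 0), with the roles of the windows exchanged.
  -- A last pair (0 , 1) admits no ribbon, yet its value `φ (suc c)` splits in the required way by
  -- `φ-suc`.
  pairing-∷ʳ-0b : ∀ c (a b : Vec Bit t) y →
                  pairing c (a ∷ʳ 0b) (b ∷ʳ y) ≐
                  pairing c a b ⊕ move y (ones b + c) (pairing (suc c) a b)
  pairing-∷ʳ-0b c []      []             zero       n h = refl
  pairing-∷ʳ-0b c []      []             (suc zero) = φ-suc c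
  pairing-∷ʳ-0b c (x ∷ a) (zero ∷ b)     y          =
    ≐-trans
      (⊕-cong (pairing-∷ʳ-0b c a b y)
              (move-cong x (cong (_+ c) (ones-∷ʳ a 0b)) (pairing-∷ʳ-0b (suc c) a b y)))
      -- Whichever move comes second costs one more power of Y, since the first has raised the
      -- counter; the totals agree.
      (move-exchange {f = pairing c a b} x y (begin
        ones a + c + (ones b + suc c)  ≡⟨ cong (_+_ (ones a + c)) (ℕ.+-suc (ones b) c) ⟩
        ones a + c + suc (ones b + c)  ≡⟨ ℕ.+-comm (ones a + c) _ ⟩
        suc (ones b + c) + (ones a + c) ≡⟨ ℕ.+-suc (ones b + c) (ones a + c) ⟨
        ones b + c + suc (ones a + c)  ≡⟨ cong (_+_ (ones b + c)) (ℕ.+-suc (ones a) c) ⟨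
        ones b + c + (ones a + suc c)  ∎))
    where open ≡-Reasoning
  pairing-∷ʳ-0b c (x ∷ a) (suc zero ∷ b) y          =
    ≐-trans (pairing-∷ʳ-0b (suc c) a b y)
      (⊕-cong {f = pairing (suc c) a b} (λ _ _ → refl)
              (move-cong y (ℕ.+-suc (ones b) c) (λ _ _ → refl)))

  -- Each 1 of `a` faces a 0: staying and moving are the two terms of `φ-suc`.
  pairing-zerosʳ : ∀ c (a : Vec Bit t) → pairing c a (zeros t) ≐ φ (ones a + c)
  pairing-zerosʳ c []               n h = refl
  pairing-zerosʳ c (zero ∷ a)           =
    ≐-trans (⊕-identityʳ (ones a + c) (pairing c a (zeros _)) (pairing (suc c) a (zeros _)))
            (pairing-zerosʳ c a)
  pairing-zerosʳ c (suc zero ∷ a)       =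
    ≐-trans
      (⊕-cong (pairing-zerosʳ c a)
        (move-cong 1b refl
          (λ n h → trans (pairing-zerosʳ (suc c) a n h)
                         (cong (λ z → φ z n h) (ℕ.+-suc (ones a) c)))))
      (≐-sym (φ-suc (ones a + c)))

  -- No ribbon can start from a 0, so each 1 of `b` merely raises the counter.
  pairing-zerosˡ : ∀ c (b : Vec Bit t) → pairing c (zeros t) b ≐ φ (ones b + c)
  pairing-zerosˡ c []               n h = refl
  pairing-zerosˡ {suc t} c (zero ∷ b)       =
    ≐-trans (⊕-identityʳ (ones (zeros t) + c) (pairing c (zeros _) b) (pairing (suc c) (zeros _) b))
            (pairing-zerosˡ c b)
  pairing-zerosˡ c (suc zero ∷ b)   n h =
    trans (pairing-zerosˡ (suc c) b n h) (cong (λ z → φ z n h) (ℕ.+-suc (ones b) c))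

  -- The right window is listed in the order in which it is read from the right.

  ⟨_,_⟩ : Vec Bit t → Vec Bit t → Series
  ⟨ a , b ⟩ = pairing 0 a (Vec.reverse b)

  -- On the left a pair is completed at the right end of the windows, which the two `∷ʳ` lemmas
  -- evaluate; on the right, after reversal, at the left end, where `pairing` computes. For the
  -- letter 0 both sides become `p₀` plus one `p₁` term for `x` and one for `y`.
  step-adjoint : ∀ c (a b : Vec Bit (suc r)) →
                 step c (λ a → ⟨ a , b ⟩) a ≐ step c (λ b → ⟨ a , b ⟩) b
  step-adjoint zero (x ∷ a) (y ∷ b)
    rewrite reverse-∷ y b | reverse-∷ʳ b 0b | reverse-∷ʳ b 1b = λ n h → begin
      (pairing 0 (a ∷ʳ 0b) (b′ ∷ʳ y) ⊕ move x (ones a) (pairing 0 (a ∷ʳ 1b) (b′ ∷ʳ y))) n h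
        ≡⟨ ⊕-cong (pairing-∷ʳ-0b 0 a b′ y)
                  (move-cong x (sym (ℕ.+-identityʳ (ones a))) (pairing-∷ʳ-1b 0 a b′ y)) n h ⟩
      ((p₀ ⊕ move y (ones b′ + 0) p₁) ⊕ move x (ones a + 0) p₁) n h
        ≡⟨ +-swapʳ (p₀ n h) (move y (ones b′ + 0) p₁ n h) _ ⟩
      ((p₀ ⊕ move x (ones a + 0) p₁) ⊕ move y (ones b′ + 0) p₁) n h
        ≡⟨ cong (ℤ._+_ ((p₀ ⊕ move x (ones a + 0) p₁) n h))
             (cong (λ z → move y z p₁ n h) (trans (ℕ.+-identityʳ _) (ones-reverse b))) ⟩
      ((p₀ ⊕ move x (ones a + 0) p₁) ⊕ move y (ones b) p₁) n h
        ∎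
    where
    open ≡-Reasoning
    b′ = Vec.reverse b
    p₀ = pairing 0 a b′
    p₁ = pairing 1 a b′
    +-swapʳ : ∀ i j l → i ℤ.+ j ℤ.+ l ≡ i ℤ.+ l ℤ.+ j
    +-swapʳ = solve-∀
  step-adjoint (suc zero) (x ∷ a) (y ∷ b)
    rewrite reverse-∷ y b | reverse-∷ʳ b 1b = pairing-∷ʳ-1b 0 a (Vec.reverse b) y

  -- The terminal weight `φ ∘ ones` is the pairing with the zero window on either side, and the
  -- initial window is zero as well, so adjointness interchanges the two ends of the word.
  transfer-reverse : ∀ r w → transfer (φ ∘ ones) w (zeros (suc r)) ≐
                             transfer (φ ∘ ones) (reverse w) (zeros (suc r))
  transfer-reverse r w n h = begin
    transfer (φ ∘ ones) w (zeros _) n h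
      ≡⟨ transfer-cong w (λ a → ≐-sym (⟨⟩-zerosʳ a)) (zeros _) n h ⟩
    transfer (λ a → ⟨ a , zeros _ ⟩) w (zeros _) n h
      ≡⟨ transfer-adjoint ⟨_,_⟩ step-adjoint w (zeros _) (zeros _) n h ⟩
    transfer (λ b → ⟨ zeros _ , b ⟩) (reverse w) (zeros _) n h
      ≡⟨ transfer-cong (reverse w) ⟨⟩-zerosˡ (zeros _) n h ⟩
    transfer (φ ∘ ones) (reverse w) (zeros _) n h
      ∎
    where
    open ≡-Reasoning
    ⟨⟩-zerosʳ : (a : Vec Bit (suc r)) → ⟨ a , zeros _ ⟩ ≐ φ (ones a)
    ⟨⟩-zerosʳ a n h = begin
      ⟨ a , zeros _ ⟩ n h      ≡⟨ cong (λ b → pairing 0 a b n h) (reverse-zeros (suc r)) ⟩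
      pairing 0 a (zeros _) n h ≡⟨ pairing-zerosʳ 0 a n h ⟩
      φ (ones a + 0) n h        ≡⟨ cong (λ k → φ k n h) (ℕ.+-identityʳ _) ⟩
      φ (ones a) n h            ∎
    ⟨⟩-zerosˡ : (b : Vec Bit (suc r)) → ⟨ zeros _ , b ⟩ ≐ φ (ones b)
    ⟨⟩-zerosˡ b n h = begin
      ⟨ zeros _ , b ⟩ n h              ≡⟨ pairing-zerosˡ 0 (Vec.reverse b) n h ⟩
      φ (ones (Vec.reverse b) + 0) n h  ≡⟨ cong (λ k → φ k n h) (ℕ.+-identityʳ _) ⟩
      φ (ones (Vec.reverse b)) n h      ≡⟨ cong (λ k → φ k n h) (ones-reverse b) ⟩
      φ (ones b) n h                    ∎

-- Words padded by finitely many zeros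

-- reach a is the number of bits of a up to its last bit 1.

reach : Vec Bit t → ℕ
reach []             = 0
reach (suc zero ∷ a) = suc (reach a)
reach (zero ∷ a) with reach a
... | zero  = 0
... | suc k = suc (suc k)

reach-≤ : ∀ (a : Vec Bit t) → reach a ≤ t
reach-≤ []             = z≤n
reach-≤ (suc zero ∷ a) = s≤s (reach-≤ a)
reach-≤ (zero ∷ a) with reach a | reach-≤ a
... | zero  | _ = z≤n
... | suc k | p = s≤s p

reach-∷ʳ-0b : ∀ (a : Vec Bit t) → reach (a ∷ʳ 0b) ≡ reach a
reach-∷ʳ-0b []             = refl
reach-∷ʳ-0b (suc zero ∷ a) = cong suc (reach-∷ʳ-0b a)
reach-∷ʳ-0b (zero ∷ a) rewrite reach-∷ʳ-0b a = refl

reach≡0⇒ones≡0 : ∀ (a : Vec Bit t) → reach a ≡ 0 → ones a ≡ 0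
reach≡0⇒ones≡0 []             eq = refl
reach≡0⇒ones≡0 (suc zero ∷ a) ()
reach≡0⇒ones≡0 (zero ∷ a)     eq with reach a in eq′
... | zero = reach≡0⇒ones≡0 a eq′

0<reach-0b∷ : ∀ (a : Vec Bit t) → 0 < reach a → reach (0b ∷ a) ≡ suc (reach a)
0<reach-0b∷ a 0<k with suc k ← reach a = refl

module _ (ω : ℕ → ℤ) where

  -- Each of n ribbons needs at most r more zeros; if the window is zero then
  -- no ribbon can be placed at all.

  transfer-zeros : ∀ N (a : Vec Bit (suc r)) n h →
                   (0 < reach a → reach a + n * suc r ≤ N + suc r) →
                   transfer (λ _ → φ ω 0) (replicate N 0b) a n h ≡ φ ω (ones a) n h
  transfer-zeros zero a zero    h p = refl
  transfer-zeros {r} zero a (suc n) h p with reach a in eq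
  ... | zero  rewrite reach≡0⇒ones≡0 a eq = refl
  -- With no zeros left, a 1 in the window and a ribbon still to place would give `suc k` + `suc r`
  -- ≤ `suc r`.
  ... | suc k = contradiction (ℕ.m+n≤o⇒m≤o _ (begin
    suc r + (k + n * suc r)    ≡⟨ ℕ.+-comm (suc r) _ ⟩
    k + n * suc r + suc r      ≡⟨ ℕ.+-assoc k (n * suc r) (suc r) ⟩
    k + (n * suc r + suc r)    ≡⟨ cong (_+_ k) (ℕ.+-comm (n * suc r) (suc r)) ⟩
    k + (suc r + n * suc r)    ≤⟨ s≤s⁻¹ (p (s≤s z≤n)) ⟩
    r                          ∎)) ℕ.1+n≰n
    where open ℕ.≤-Reasoning
  transfer-zeros {r} (suc N) (zero ∷ a) n h p = begin
    transfer (λ _ → φ ω 0) (replicate N 0b) (a ∷ʳ 0b) n h ℤ.+ 0ℤ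
      ≡⟨ ℤ.+-identityʳ _ ⟩
    transfer (λ _ → φ ω 0) (replicate N 0b) (a ∷ʳ 0b) n h
      ≡⟨ transfer-zeros N (a ∷ʳ 0b) n h p′ ⟩
    φ ω (ones (a ∷ʳ 0b)) n h
      ≡⟨ cong (λ k → φ ω k n h) (ones-∷ʳ a 0b) ⟩
    φ ω (ones a) n h
      ∎
    where
    open ≡-Reasoning
    p′ : 0 < reach (a ∷ʳ 0b) → reach (a ∷ʳ 0b) + n * suc r ≤ N + suc r
    p′ rewrite reach-∷ʳ-0b a = λ 0<k → s≤s⁻¹
      (subst (λ k → k + n * suc r ≤ suc N + suc r) (0<reach-0b∷ a 0<k)
        (p (subst (0 <_) (sym (0<reach-0b∷ a 0<k)) (s≤s z≤n))))
  transfer-zeros {r} (suc N) (suc zero ∷ a) n h p = begin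
    transfer (λ _ → φ ω 0) (replicate N 0b) (a ∷ʳ 0b) n h ℤ.+
      move 1b (ones a) (transfer (λ _ → φ ω 0) (replicate N 0b) (a ∷ʳ 1b)) n h
      ≡⟨ cong₂ ℤ._+_
           (trans (transfer-zeros N (a ∷ʳ 0b) n h p₀) (cong (λ k → φ ω k n h) (ones-∷ʳ a 0b)))
           (ribbon n p) ⟩
    (φ ω (ones a) ⊕ move 1b (ones a) (φ ω (suc (ones a)))) n h
      ≡⟨ φ-suc ω (ones a) n h ⟨
    φ ω (suc (ones a)) n h
      ∎
    where
    open ≡-Reasoning
    p₀ : 0 < reach (a ∷ʳ 0b) → reach (a ∷ʳ 0b) + n * suc r ≤ N + suc r
    p₀ rewrite reach-∷ʳ-0b a = λ _ → s≤s⁻¹ (p (s≤s z≤n))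
    ribbon : ∀ n → (0 < suc (reach a) → suc (reach a) + n * suc r ≤ suc N + suc r) →
             move 1b (ones a) (transfer (λ _ → φ ω 0) (replicate N 0b) (a ∷ʳ 1b)) n h ≡
             move 1b (ones a) (φ ω (suc (ones a))) n h
    ribbon zero    p = refl
    ribbon (suc n) p =
      -- The new window ends in 1; its reach, at most `suc r`, is paid for by the block of the
      -- ribbon just placed.
      trans (transfer-zeros N (a ∷ʳ 1b) n _ (λ _ →
              ℕ.≤-trans (ℕ.+-monoˡ-≤ (n * suc r) (reach-≤ (a ∷ʳ 1b)))
                        (ℕ.m+n≤o⇒n≤o (reach a) (s≤s⁻¹ (p (s≤s z≤n))))))
            (cong (λ k → φ ω k n (h + ones a)) (ones-∷ʳ a 1b))

  -- Every window has reach at most `suc r`, so `n * suc r` zeros suffice for all orders up to `n`,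
  -- whichever window `w` leaves behind.
  transfer-padded : ∀ w n N h → n * suc r ≤ N →
    transfer (λ _ → φ ω 0) (w ++ replicate N 0b) (zeros (suc r)) n h ≡
    transfer (φ ω ∘ ones) w (zeros (suc r)) n h
  transfer-padded {r} w n N h n*r≤N = begin
    transfer (λ _ → φ ω 0) (w ++ replicate N 0b) (zeros (suc r)) n h
      ≡⟨ cong (λ F → F (zeros (suc r)) n h) (foldr-++ step _ w (replicate N 0b)) ⟩
    transfer (transfer (λ _ → φ ω 0) (replicate N 0b)) w (zeros (suc r)) n h
      ≡⟨ transfer-cong-≤ w n (λ a i i≤n h → transfer-zeros N a i h (λ _ → bound a i≤n))
           (zeros (suc r)) h ⟩
    transfer (φ ω ∘ ones) w (zeros (suc r)) n h
      ∎
    where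
    open ≡-Reasoning
    bound : ∀ (a : Vec Bit (suc r)) {i} → i ≤ n → reach a + i * suc r ≤ N + suc r
    bound a {i} i≤n = subst (reach a + i * suc r ≤_) (ℕ.+-comm (suc r) N)
      (ℕ.+-mono-≤ (reach-≤ a) (ℕ.≤-trans (ℕ.*-monoˡ-≤ (suc r) i≤n) n*r≤N))

-- Listing the placements by increasing position

place : ∀ {P : Set} → Dec P → ∀ i → List (Vec ℤ n) → List (Vec ℤ (suc n))
place (yes _) i iss = map (i ∷_) iss
place (no  _) i iss = []

-- Decides the positions m, ..., m + N - 1 in turn, first leaving `+ m` free and then putting a
-- ribbon there, so that its branching matches the two terms of `step`.
scan : ℕ → BitSeq → ℕ → ℕ → ∀ n → List (Vec ℤ n)
scan r s m zero    zero    = [] ∷ []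
scan r s m zero    (suc n) = []
scan r s m (suc N) zero    = scan r s (suc m) N zero
scan r s m (suc N) (suc n) =
  scan r s (suc m) N (suc n) ++
  place (addable? r s (+ m)) (+ m) (scan r (addRibbon r s (+ m)) (suc m) N n)

Between : ℕ → ℕ → ℤ → Set
Between m N i = ∃[ k ] i ≡ + k × m ≤ k × k < m + N

between-suc : ∀ {m N i} → Between (suc m) N i → Between m (suc N) i
between-suc {m} {N} (k , i≡k , m<k , k<) =
  k , i≡k , ℕ.<⇒≤ m<k , subst (k <_) (sym (ℕ.+-suc m N)) k<

between-pred : ∀ {m N i} → + m ℤ.< i → Between m (suc N) i → Between (suc m) N i
between-pred {m} {N} (ℤ.+<+ m<k) (k , refl , _ , k<) =
  k , refl , m<k , subst (k <_) (ℕ.+-suc m N) k<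

between-first : ∀ m N → Between m (suc N) (+ m)
between-first m N = m , refl , ℕ.≤-refl , ℕ.m<m+n m (s≤s z≤n)

between⇒< : ∀ {m N i} → Between (suc m) N i → + m ℤ.< i
between⇒< (_ , refl , m<k , _) = ℤ.+<+ m<k

between∧≢⇒< : ∀ {m N i} → Between m N i → i ≢ + m → + m ℤ.< i
between∧≢⇒< (_ , refl , m≤k , _) i≢m = ℤ.+<+ (ℕ.≤∧≢⇒< m≤k (i≢m ∘ cong ℤ.+_ ∘ sym))

∷-linked : ∀ {i} {is : Vec ℤ n} → All (i ℤ.<_) is → Linked ℤ._<_ is → Linked ℤ._<_ (i ∷ is)
∷-linked []        []  = [-]
∷-linked (p ∷ _) lnk = p ∷ lnk

linked-∷ : ∀ {i} {is : Vec ℤ n} → Linked ℤ._<_ (i ∷ is) → All (i ℤ.<_) is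
linked-∷ [-]       = []
linked-∷ (p ∷ lnk) = Linked⇒All ℤ.<-trans p lnk

∈-place⁺ : ∀ {P : Set} (P? : Dec P) {i iss} {is : Vec ℤ n} →
           P → is ∈ iss → i ∷ is ∈ place P? i iss
∈-place⁺ (yes _)  p is∈ = ∈-map⁺ _ is∈
∈-place⁺ (no ¬p) p is∈ = contradiction p ¬p

∈-place⁻ : ∀ {P : Set} (P? : Dec P) i (iss : List (Vec ℤ n)) {js} → js ∈ place P? i iss →
           P × ∃[ is ] is ∈ iss × js ≡ i ∷ is
∈-place⁻ (yes p) i iss js∈ = p , ∈-map⁻ _ js∈

∈-scan⁺ : ∀ m N {s} {is : Vec ℤ n} → IsPlacement r s is → All (Between m N) is →
          is ∈ scan r s m N n
∈-scan⁺ m zero    {is = []}     p bs = here refl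
∈-scan⁺ m zero    {is = i ∷ is} p ((k , _ , m≤k , k<m+0) ∷ _) =
  contradiction (ℕ.≤-<-trans m≤k (subst (k <_) (ℕ.+-identityʳ m) k<m+0)) (ℕ.<-irrefl refl)
∈-scan⁺ m (suc N) {is = []}     p bs = ∈-scan⁺ (suc m) N p []
∈-scan⁺ {r = r} m (suc N) {s} {i ∷ is} (lnk , perf) (b ∷ bs) with i ℤ.≟ + m
∈-scan⁺ {r = r} m (suc N) {s} {i ∷ is} (lnk , a ∷ perf) (b ∷ bs) | yes refl =
  ∈-++⁺ʳ _ (∈-place⁺ (addable? r s (+ m)) a
    (∈-scan⁺ (suc m) N (Linked.tail lnk , perf)
      (All.map (λ (lt , b) → between-pred lt b) (All.zip (linked-∷ lnk , bs)))))
... | no i≢m = ∈-++⁺ˡ (∈-scan⁺ (suc m) N (lnk , perf)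
    (between-pred m<i b ∷
     All.map (λ (lt , b) → between-pred (ℤ.<-trans m<i lt) b) (All.zip (linked-∷ lnk , bs))))
  where
  m<i = between∧≢⇒< b i≢m

∈-scan⁻ : ∀ r s m N {n} {is : Vec ℤ n} → is ∈ scan r s m N n →
          IsPlacement r s is × All (Between m N) is
∈-scan⁻ r s m zero    {zero} (here refl) = ([] , []) , []
∈-scan⁻ r s m (suc N) {zero} {[]} is∈ = ([] , []) , []
∈-scan⁻ r s m (suc N) {suc n} is∈ with ∈-++⁻ (scan r s (suc m) N (suc n)) is∈
... | inj₁ is∈ˡ with p , bs ← ∈-scan⁻ r s (suc m) N is∈ˡ = p , All.map between-suc bs
... | inj₂ is∈ʳ
  with a , is , is∈′ , refl ← ∈-place⁻ (addable? r s (+ m)) (+ m) _ is∈ʳ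
  with (lnk , perf) , bs ← ∈-scan⁻ r (addRibbon r s (+ m)) (suc m) N is∈′ =
  (∷-linked (All.map between⇒< bs) lnk , a ∷ perf) , between-first m N ∷ All.map between-suc bs

place-unique : ∀ {P : Set} (P? : Dec P) i {iss : List (Vec ℤ n)} →
               Unique iss → Unique (place P? i iss)
place-unique (yes _) i u = Unique.map⁺ ∷-injectiveʳ u
place-unique (no  _) i u = []

scan-unique : ∀ r s m N n → Unique (scan r s m N n)
scan-unique r s m zero    zero    = [] ∷ []
scan-unique r s m zero    (suc n) = []
scan-unique r s m (suc N) zero    = scan-unique r s (suc m) N zero
scan-unique r s m (suc N) (suc n) =
  Unique.++⁺ (scan-unique r s (suc m) N (suc n))
    (place-unique (addable? r s (+ m)) (+ m) (scan-unique r _ (suc m) N n))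
    disjoint
  where
  -- A common element would begin with `+ m` by the second list and with a larger position by the
  -- first.
  disjoint : ∀ {is} → is ∈ scan r s (suc m) N (suc n) ×
             is ∈ place (addable? r s (+ m)) (+ m) (scan r (addRibbon r s (+ m)) (suc m) N n) →
             ⊥
  disjoint (is∈ˡ , is∈ʳ)
    with _ , is , _ , refl ← ∈-place⁻ (addable? r s (+ m)) (+ m) _ is∈ʳ
    with _ , b ∷ _ ← ∈-scan⁻ r s (suc m) N is∈ˡ = ℤ.<-irrefl refl (between⇒< b)

∈-vectors⁻ : ∀ {A : Set} (xs : List A) n {v : Vec A n} → v ∈ vectors xs n → All (_∈ xs) v
∈-vectors⁻ xs zero    {[]} v∈ = []
∈-vectors⁻ xs (suc n) v∈
  with _ , _ , x∈ , v∈′ , refl ← ∈-cartesianProductWith⁻ _∷_ xs (vectors xs n) v∈ =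
  x∈ ∷ ∈-vectors⁻ xs n v∈′

∈-placements⇒between : ∀ w r n {is} → is ∈ placements w r n →
                       All (Between 0 (length w + n * r)) is
∈-placements⇒between w r n is∈ = All.map between (∈-vectors⁻ _ n
  (proj₁ (∈-filter⁻ (isPlacement? r (extend w)) {xs = vectors _ n} is∈)))
  where
  between : ∀ {i} → i ∈ map +_ (upTo (length w + n * r)) → Between 0 (length w + n * r) i
  between i∈ with k , k∈ , refl ← ∈-map⁻ +_ i∈ = k , refl , z≤n , ∈-upTo⁻ k∈

-- Both lists are free of repetitions and have the same members, so they agree up to order, which a
-- sum does not see.
placements↭scan : ∀ w r n → placements w r n ↭ scan r (extend w) 0 (length w + n * r) n
placements↭scan w r n =
  ∼bag⇒↭ (unique∧set⇒bag (placements-unique w r n) (scan-unique r (extend w) 0 N n)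
    (mk⇔ (λ is∈ → ∈-scan⁺ 0 N (∈-placements⁻ w r is∈) (∈-placements⇒between w r n is∈))
         (λ is∈ → ∈-placements⁺ w r (proj₁ (∈-scan⁻ r (extend w) 0 N is∈)))))
  where N = length w + n * r

-- Scanning through a window

-- From position m - t rightwards, `s` is `u` followed by zeros. Bits further left are
-- unconstrained: ribbons of length `t` at `m` or later never look at them.
Reads : BitSeq → ℕ → ℕ → List Bit → Set
Reads s m t u = ∀ j → s (+ m ℤ.- + t ℤ.+ + j) ≡ extend u (+ j)

private
  pos-tail : ∀ m t j → + m ℤ.- + suc t ℤ.+ + suc j ≡ + m ℤ.- + t ℤ.+ + j
  pos-tail m t j = lemma (+ m) (+ t) (+ j)
    where
    lemma : ∀ m t j → m ℤ.- (+ 1 ℤ.+ t) ℤ.+ (+ 1 ℤ.+ j) ≡ m ℤ.- t ℤ.+ j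
    lemma = solve-∀

  pos-shift : ∀ m t j → + suc m ℤ.- + suc t ℤ.+ + j ≡ + m ℤ.- + t ℤ.+ + j
  pos-shift m t j = lemma (+ m) (+ t) (+ j)
    where
    lemma : ∀ m t j → (+ 1 ℤ.+ m) ℤ.- (+ 1 ℤ.+ t) ℤ.+ j ≡ m ℤ.- t ℤ.+ j
    lemma = solve-∀

  pos-end : ∀ m t → + m ℤ.- + t ℤ.+ + t ≡ + m
  pos-end m t = lemma (+ m) (+ t)
    where
    lemma : ∀ m t → m ℤ.- t ℤ.+ t ≡ m
    lemma = solve-∀

  pos-head : ∀ m t → + m ℤ.- + t ℤ.+ + 0 ≡ + m ℤ.- + t
  pos-head m t = ℤ.+-identityʳ _

reads-tail : ∀ s m t {x u} → Reads s m (suc t) (x ∷ u) → Reads s m t u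
reads-tail s m t rd j = trans (cong s (sym (pos-tail m t j))) (rd (suc j))

reads-shift : ∀ s m t {u} → Reads s m t u → Reads s (suc m) (suc t) u
reads-shift s m t rd j = trans (cong s (pos-shift m t j)) (rd j)

reads-head : ∀ s m t {x u} → Reads s m t (x ∷ u) → s (+ m ℤ.- + t) ≡ x
reads-head s m t rd = trans (cong s (sym (pos-head m t))) (rd 0)

extend-++ : ∀ (a : Vec Bit t) c v → extend (toList a ++ c ∷ v) (+ t) ≡ c
extend-++ []      c v = refl
extend-++ (x ∷ a) c v = extend-++ a c v

extend-++-≢ : ∀ (a : Vec Bit t) c d v j → j ≢ t →
              extend (toList a ++ c ∷ v) (+ j) ≡ extend (toList a ++ d ∷ v) (+ j)
extend-++-≢ []      c d v zero    j≢t = contradiction refl j≢t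
extend-++-≢ []      c d v (suc j) j≢t = refl
extend-++-≢ (x ∷ a) c d v zero    j≢t = refl
extend-++-≢ (x ∷ a) c d v (suc j) j≢t = extend-++-≢ a c d v j (j≢t ∘ cong suc)

reads-end : ∀ s m (a : Vec Bit t) {c v} → Reads s m t (toList a ++ c ∷ v) → s (+ m) ≡ c
reads-end {t} s m a {c} {v} rd = begin
  s (+ m)                          ≡⟨ cong s (pos-end m t) ⟨
  s (+ m ℤ.- + t ℤ.+ + t)          ≡⟨ rd t ⟩
  extend (toList a ++ c ∷ v) (+ t)  ≡⟨ extend-++ a c v ⟩
  c                                ∎
  where open ≡-Reasoning

-- Of the two bits changed, the one at `+ m` has index `t` in the word, while the one at m - (t + 1)
-- lies just left of where reading starts; hence only `c` changes.
reads-addRibbon : ∀ s m (a : Vec Bit t) {c v} → Reads s m t (toList a ++ c ∷ v) →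
                  Reads (addRibbon (suc t) s (+ m)) m t (toList a ++ 1b ∷ v)
reads-addRibbon {t} s m a {c} {v} rd j with + m ℤ.- + t ℤ.+ + j ℤ.≟ + m
... | yes eq = sym (trans (cong (λ j → extend (toList a ++ 1b ∷ v) (+ j)) j≡t) (extend-++ a 1b v))
  where
  j≡t : j ≡ t
  j≡t = ℤ.+-injective (+-cancelˡ (+ m ℤ.- + t) _ _ (trans eq (sym (pos-end m t))))
... | no ≢m with + m ℤ.- + t ℤ.+ + j ℤ.≟ + m ℤ.- + suc t
...   | yes eq = contradiction (ℤ.+-injective (+-cancelˡ (+ m ℤ.- + suc t) _ _
          (trans (pos-tail m t j) (trans eq (sym (pos-head m (suc t))))))) λ ()
...   | no _ = trans (rd j) (extend-++-≢ a c 1b v j (λ { refl → ≢m (pos-end m t) }))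

reads-∷ʳ : ∀ s m t (a : Vec Bit t) c {v} → Reads s m t (toList a ++ c ∷ v) →
           Reads s (suc m) (suc t) (toList (a ∷ʳ c) ++ v)
reads-∷ʳ s m t a c {v} rd = reads-shift s m t {toList (a ∷ʳ c) ++ v} (subst (Reads s m t) (sym eq) rd)
  where
  eq : toList (a ∷ʳ c) ++ v ≡ toList a ++ c ∷ v
  eq = trans (cong (_++ v) (toList-∷ʳ c a)) (∷ʳ-++ (toList a) c v)

reads-sum : ∀ s m (a : Vec Bit t) {u} → Reads s m t (toList a ++ u) →
            sum (map (λ j → toℕ (s (+ m ℤ.- + suc j))) (upTo t)) ≡ ones a
reads-sum         s m []      rd = refl
reads-sum {suc t} s m (x ∷ a) rd = begin
  -- The height sum runs from right to left, so the head `x` of the window is its last summand.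
  sum (map bit (upTo (suc t)))                ≡⟨ cong (sum ∘ map bit) (upTo-∷ʳ t) ⟨
  sum (map bit (upTo t ++ t ∷ []))            ≡⟨ cong sum (map-++ bit (upTo t) (t ∷ [])) ⟩
  sum (map bit (upTo t) ++ bit t ∷ [])        ≡⟨ sum-++ (map bit (upTo t)) (bit t ∷ []) ⟩
  sum (map bit (upTo t)) + (bit t + 0)        ≡⟨ cong₂ _+_ (reads-sum s m a (reads-tail s m t rd))
                                                  (ℕ.+-identityʳ (bit t)) ⟩
  ones a + bit t                              ≡⟨ ℕ.+-comm (ones a) (bit t) ⟩
  bit t + ones a                              ≡⟨ cong (λ b → toℕ b + ones a)
                                                  (reads-head s m (suc t) rd) ⟩
  toℕ x + ones a                              ∎
  where
  open ≡-Reasoning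
  bit : ℕ → ℕ
  bit j = toℕ (s (+ m ℤ.- + suc j))

reads-extend : ∀ t w → Reads (extend w) 0 t (toList (zeros t) ++ w)
reads-extend zero    w j       = refl
reads-extend (suc t) w (suc j) = trans (cong (extend w) (pos-tail 0 t j)) (reads-extend t w j)
reads-extend (suc t) []      zero = refl
reads-extend (suc t) (b ∷ w) zero = refl

-- Weighted sums over the scan

total : ∀ {A : Set} → (A → ℤ) → List A → ℤ
total F xs = foldr ℤ._+_ 0ℤ (map F xs)

total-++ : ∀ {A : Set} (F : A → ℤ) xs ys → total F (xs ++ ys) ≡ total F xs ℤ.+ total F ys
total-++ F []       ys = sym (ℤ.+-identityˡ _)
total-++ F (x ∷ xs) ys = trans (cong (ℤ._+_ (F x)) (total-++ F xs ys)) (sym (ℤ.+-assoc (F x) _ _))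

total-cong : ∀ {A : Set} {F G : A → ℤ} → (∀ x → F x ≡ G x) → ∀ xs → total F xs ≡ total G xs
total-cong F≗G xs = cong (foldr ℤ._+_ 0ℤ) (map-cong F≗G xs)

total-↭ : ∀ {A : Set} (F : A → ℤ) {xs ys} → xs ↭ ys → total F xs ≡ total F ys
total-↭ F xs↭ys =
  foldr-commMonoid ℤ-+-0.setoid ℤ-+-0.isCommutativeMonoid (↭⇒↭ₛ (↭.map⁺ F xs↭ys))
  where module ℤ-+-0 = CommutativeMonoid ℤ.+-0-commutativeMonoid

module _ (ω : ℕ → ℤ) where

  -- Here `h` is the height accumulated by earlier ribbons, in accordance with the second index of a
  -- `Series`.
  weight : ∀ r s → ℕ → Vec ℤ n → ℤ
  weight r s h is = ω (h + totalHeight r s is)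

  total-place : ∀ {P : Set} (P? : Dec P) r s i h (iss : List (Vec ℤ n)) → P →
    total (weight r s h) (place P? i iss) ≡
    total (weight r (addRibbon r s i) (h + ribbonHeight r s i)) iss
  total-place (yes _) r s i h iss p = begin
    total (weight r s h) (map (i ∷_) iss)
      ≡⟨ cong (foldr ℤ._+_ 0ℤ) (map-∘ iss) ⟨
    total (weight r s h ∘ (i ∷_)) iss
      ≡⟨ total-cong (λ is → cong ω (sym (ℕ.+-assoc h (ribbonHeight r s i) _))) iss ⟩
    total (weight r (addRibbon r s i) (h + ribbonHeight r s i)) iss
      ∎
    where open ≡-Reasoning
  total-place (no ¬p) r s i h iss p = contradiction p ¬p

  total-place-¬ : ∀ {P : Set} (P? : Dec P) i (F : Vec ℤ (suc n) → ℤ) iss → ¬ P →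
                  total F (place P? i iss) ≡ 0ℤ
  total-place-¬ (yes p) i F iss ¬p = contradiction p ¬p
  total-place-¬ (no  _) i F iss ¬p = refl

  -- Leaving `+ m` free and placing a ribbon there give the two terms of `step`. The end value
  -- `φ ω 0` is `ω h` at order 0 and vanishes at higher orders: once the word is exhausted, no
  -- ribbon may be outstanding.
  total-scan : ∀ s m (a : Vec Bit (suc r)) v n h → Reads s m (suc r) (toList a ++ v) →
    total (weight (suc r) s h) (scan (suc r) s m (length v) n) ≡
    transfer (λ _ → φ ω 0) v a n h
  total-scan s m a       []      zero    h rd =
    trans (ℤ.+-identityʳ _) (cong ω (ℕ.+-identityʳ h))
  total-scan s m a       []      (suc n) h rd = refl
  total-scan {r} s m (x ∷ a) (zero ∷ v) zero h rd = begin
    total (weight (suc r) s h) (scan (suc r) s (suc m) (length v) zero)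
      ≡⟨ total-scan s (suc m) (a ∷ʳ 0b) v zero h
           (reads-∷ʳ s m r a 0b (reads-tail s m r rd)) ⟩
    transfer (λ _ → φ ω 0) v (a ∷ʳ 0b) zero h
      ≡⟨ ℤ.+-identityʳ _ ⟨
    transfer (λ _ → φ ω 0) v (a ∷ʳ 0b) zero h ℤ.+ 0ℤ
      ≡⟨ cong (ℤ._+_ (transfer (λ _ → φ ω 0) v (a ∷ʳ 0b) zero h)) (move-zero x) ⟨
    transfer (λ _ → φ ω 0) (zero ∷ v) (x ∷ a) zero h
      ∎
    where
    open ≡-Reasoning
    move-zero : ∀ x {k f} → move x k f zero h ≡ 0ℤ
    move-zero zero       = refl
    move-zero (suc zero) = refl
  total-scan {r} s m (x ∷ a) (suc zero ∷ v) zero h rd =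
    total-scan s (suc m) (a ∷ʳ 1b) v zero h (reads-∷ʳ s m r a 1b (reads-tail s m r rd))
  total-scan {r} s m (x ∷ a) (c ∷ v) (suc n) h rd = begin
    total (weight (suc r) s h) (rest ++ place add? (+ m) added)
      ≡⟨ total-++ (weight (suc r) s h) rest (place add? (+ m) added) ⟩
    total (weight (suc r) s h) rest ℤ.+ total (weight (suc r) s h) (place add? (+ m) added)
      ≡⟨ cong (ℤ._+ total (weight (suc r) s h) (place add? (+ m) added))
           (total-scan s (suc m) (a ∷ʳ c) v (suc n) h (reads-∷ʳ s m r a c rd′)) ⟩
    transfer (λ _ → φ ω 0) v (a ∷ʳ c) (suc n) h ℤ.+
      total (weight (suc r) s h) (place add? (+ m) added)
      ≡⟨ ribbon x c (reads-head s m (suc r) rd) (reads-end s m a rd′) ⟩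
    transfer (λ _ → φ ω 0) (c ∷ v) (x ∷ a) (suc n) h
      ∎
    where
    open ≡-Reasoning
    rd′   = reads-tail s m r rd
    add?  = addable? (suc r) s (+ m)
    rest  = scan (suc r) s (suc m) (length v) (suc n)
    added = scan (suc r) (addRibbon (suc r) s (+ m)) (suc m) (length v) n
    ribbon : ∀ x c → s (+ m ℤ.- + suc r) ≡ x → s (+ m) ≡ c →
      transfer (λ _ → φ ω 0) v (a ∷ʳ c) (suc n) h ℤ.+
        total (weight (suc r) s h) (place add? (+ m) added) ≡
      transfer (λ _ → φ ω 0) (c ∷ v) (x ∷ a) (suc n) h
    ribbon zero zero x≡ c≡ = cong (ℤ._+_ (transfer (λ _ → φ ω 0) v (a ∷ʳ 0b) (suc n) h))
      (total-place-¬ add? (+ m) (weight (suc r) s h) added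
      λ (x≡1 , _) → contradiction (trans (sym x≡) x≡1) λ ())
    ribbon (suc zero) zero x≡ c≡ = cong (ℤ._+_ (transfer (λ _ → φ ω 0) v (a ∷ʳ 0b) (suc n) h)) (begin
      total (weight (suc r) s h) (place add? (+ m) added)
        ≡⟨ total-place add? (suc r) s (+ m) h added (x≡ , c≡) ⟩
      total (weight (suc r) (addRibbon (suc r) s (+ m)) (h + ribbonHeight (suc r) s (+ m))) added
        ≡⟨ total-scan (addRibbon (suc r) s (+ m)) (suc m) (a ∷ʳ 1b) v n _
             (reads-∷ʳ (addRibbon (suc r) s (+ m)) m r a 1b (reads-addRibbon s m a rd′)) ⟩
      transfer (λ _ → φ ω 0) v (a ∷ʳ 1b) n (h + ribbonHeight (suc r) s (+ m))
        ≡⟨ cong (λ k → transfer (λ _ → φ ω 0) v (a ∷ʳ 1b) n (h + k)) (reads-sum s m a rd′) ⟩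
      transfer (λ _ → φ ω 0) v (a ∷ʳ 1b) n (h + ones a)
        ∎)
    ribbon x (suc zero) x≡ c≡ = trans
      (cong (ℤ._+_ (transfer (λ _ → φ ω 0) v (a ∷ʳ 1b) (suc n) h))
        (total-place-¬ add? (+ m) (weight (suc r) s h) added
        λ (_ , c≡0) → contradiction (trans (sym c≡) c≡0) λ ()))
      (ℤ.+-identityʳ _)

  total-placements : ∀ r w n →
    total (weight (suc r) (extend w) 0) (placements w (suc r) n) ≡
    transfer (φ ω ∘ ones) w (zeros (suc r)) n 0
  total-placements r w n = begin
    total (weight (suc r) (extend w) 0) (placements w (suc r) n)
      ≡⟨ total-↭ _ (placements↭scan w (suc r) n) ⟩
    total (weight (suc r) (extend w) 0) (scan (suc r) (extend w) 0 (length w + n * suc r) n)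
      ≡⟨ cong (λ N → total (weight (suc r) (extend w) 0) (scan (suc r) (extend w) 0 N n))
           length-padded ⟨
    total (weight (suc r) (extend w) 0) (scan (suc r) (extend w) 0 (length padded) n)
      ≡⟨ total-scan (extend w) 0 (zeros (suc r)) padded n 0 reads-padded ⟩
    transfer (λ _ → φ ω 0) padded (zeros (suc r)) n 0
      ≡⟨ transfer-padded ω w n (n * suc r) 0 ℕ.≤-refl ⟩
    transfer (φ ω ∘ ones) w (zeros (suc r)) n 0
      ∎
    where
    open ≡-Reasoning
    -- The padding makes the word exactly as long as the range of positions searched by
    -- `placements`, without changing the bit sequence.
    padded = w ++ replicate (n * suc r) 0b
    length-padded : length padded ≡ length w + n * suc r
    length-padded = trans (length-++ w) (cong (_+_ (length w)) (length-replicate _))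
    reads-padded : Reads (extend w) 0 (suc r) (toList (zeros (suc r)) ++ padded)
    reads-padded j = trans (reads-extend (suc r) w j)
      (extend-padded (toList (zeros (suc r))) w (n * suc r) j)
      where
      extend-zeros : ∀ N j → extend (replicate N 0b) (+ j) ≡ 0b
      extend-zeros zero    j       = refl
      extend-zeros (suc N) zero    = refl
      extend-zeros (suc N) (suc j) = extend-zeros N j
      extend-padded : ∀ u w N j → extend (u ++ w) (+ j) ≡ extend (u ++ w ++ replicate N 0b) (+ j)
      extend-padded (x ∷ u) w       N zero    = refl
      extend-padded (x ∷ u) w       N (suc j) = extend-padded u w N j
      extend-padded []      (x ∷ w) N zero    = refl
      extend-padded []      (x ∷ w) N (suc j) = extend-padded [] w N j
      extend-padded []      []      N j       = sym (extend-zeros N j)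

-- Coefficients

coeff-+ₚ : ∀ p q k → coeff (p +ₚ q) k ≡ coeff p k ℤ.+ coeff q k
coeff-+ₚ []      q       k       = sym (ℤ.+-identityˡ _)
coeff-+ₚ (a ∷ p) []      k       = sym (ℤ.+-identityʳ _)
coeff-+ₚ (a ∷ p) (b ∷ q) zero    = refl
coeff-+ₚ (a ∷ p) (b ∷ q) (suc k) = coeff-+ₚ p q k

coeff-sumₚ : ∀ {A : Set} (P : A → ℤ[Y]) xs k →
             coeff (sumₚ (map P xs)) k ≡ total (λ x → coeff (P x) k) xs
coeff-sumₚ P []       k = refl
coeff-sumₚ P (x ∷ xs) k =
  trans (coeff-+ₚ (P x) _ k) (cong (ℤ._+_ (coeff (P x) k)) (coeff-sumₚ P xs k))

claim1p1p2 : (r : ℕ) .{{_ : NonZero r}} (w : List Bit) → R₀₀ w r ≈ R₀₀ (reverse w) r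
claim1p1p2 zero    w     = contradiction refl (≢-nonZero⁻¹ 0)
claim1p1p2 (suc r) w n k = begin
  coeff (R₀₀ w (suc r) n) k
    ≡⟨ coeff-R₀₀ w ⟩
  transfer (φ ω ∘ ones) w (zeros (suc r)) n 0
    ≡⟨ transfer-reverse ω r w n 0 ⟩
  transfer (φ ω ∘ ones) (reverse w) (zeros (suc r)) n 0
    ≡⟨ coeff-R₀₀ (reverse w) ⟨
  coeff (R₀₀ (reverse w) (suc r) n) k
    ∎
  where
  open ≡-Reasoning
  -- With this `ω`, the weight of a placement is its contribution to the coefficient of Yᵏ.
  ω : ℕ → ℤ
  ω h = coeff (Y^ h) k
  coeff-R₀₀ : ∀ w → coeff (R₀₀ w (suc r) n) k ≡ transfer (φ ω ∘ ones) w (zeros (suc r)) n 0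
  coeff-R₀₀ w = trans (coeff-sumₚ _ (placements w (suc r) n) k) (total-placements ω r w n)
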